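{- Let $r=[r_0,\ldots,r_m]$ and $c=[c_0,\ldots,c_n]$ be selections of rows and columns of the Pascal upper triangular matrix $T$. If $r_0>c_n$, then $T_{r,c}$ is the zero matrix and has rank $0$. Otherwise, define $M:=\max\{i : r_i\le c_n\}$, $\beta_0:=\min\{k : r_0\le c_k\}$, and for $i=1,\ldots,M$, $\beta_i:=\max\{\min\{k: r_i\le c_k\},\ \beta_{i-1}+1\}$; let $p:=\max\{i\in\{0,\ldots,M\} : \beta_i\le n\}$, $\alpha=[0,1,\ldots,p]$, $\beta=[\beta_0,\ldots,\beta_p]$, $\hat r=[r_0,\ldots,r_p]$ and $\hat c=[c_{\beta_0},\ldots,c_{\beta_p}]$. Then $\{\hat r,\hat c\}$ is a maximal ordered sub-pair of $\{r,c\}$; consequently $\operatorname{rank}(T_{r,c})=p+1$, $T_{\hat r,\hat c}$ is invertible, the rows of $T_{\hat r,c}$ form a basis of the row space of $T_{r,c}$, and the columns of $T_{r,\hat c}$ form a basis of the column space of $T_{r,c}$.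
   Context: The Pascal upper triangular matrix is the infinite matrix $T=(T_{i,j})_{i,j\ge 0}$ with $T_{i,j}=\binom{j}{i}$, where $\binom{j}{i}:=0$ if $i>j$ (rows and columns indexed from $0$). A selection of rows (resp. columns) is a strictly increasing finite sequence of nonnegative integers. For selections $r=[r_0,\ldots,r_m]$ and $c=[c_0,\ldots,c_n]$, $T_{r,c}$ denotes the $(m+1)\times(n+1)$ matrix whose $(i,j)$ entry is $\binom{c_j}{r_i}$. A pair $\{\hat r,\hat c\}$ is an ordered sub-pair of $\{r,c\}$ of length $p+1$ if $\hat r=[\hat r_0,\ldots,\hat r_p]$ is a subsequence of $r$, $\hat c=[\hat c_0,\ldots,\hat c_p]$ is a subsequence of $c$, and $\hat r_i\le \hat c_i$ for all $i=0,\ldots,p$ (the empty pair has length $0$). It is maximal if no ordered sub-pair of $\{r,c\}$ has length greater than $p+1$. -}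

module Defs where

open import Data.Bool using (if_then_else_)
open import Data.Fin as Fin using (Fin; zero; suc; toℕ; fromℕ; fromℕ<; inject≤)
import Data.Fin.Properties as Fin
open import Data.Integer using (+_)
open import Data.Nat using (ℕ; zero; suc; _≤_; _<_; _⊔_; _≤?_; z≤n; s≤s)
open import Data.Nat.Combinatorics using (_C_)
import Data.Nat.Properties as ℕ
open import Data.Product using (∃; ∃-syntax; _×_; _,_; proj₁; proj₂)
open import Data.Rational using (ℚ; 0ℚ; 1ℚ; _/_; _*_)
open import Data.Rational.Properties using (+-0-commutativeMonoid)
open import Data.Sum using (inj₁; inj₂)
open import Data.Vec.Functional using (Vector; head; last; transpose)
open import Function using (_∘_)
open import Level using (0ℓ)
open import Relation.Binary.Core using (_Preserves_⟶_)
open import Relation.Binary.PropositionalEquality using (_≡_; _≗_; refl; sym; subst)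
open import Relation.Nullary using (yes; no; does; contradiction)
open import Relation.Unary using (Pred; Decidable)

open import Algebra.Properties.CommutativeMonoid.Sum +-0-commutativeMonoid
  using (sum-syntax)

Matrix : ℕ → ℕ → Set
Matrix m n = Vector (Vector ℚ n) m

0ᴹ : ∀ {m n} → Matrix m n
0ᴹ i j = 0ℚ

1ᴹ : ∀ {n} → Matrix n n
1ᴹ i j = if does (i Fin.≟ j) then 1ℚ else 0ℚ

infix 4 _≈ᴹ_
_≈ᴹ_ : ∀ {m n} → Matrix m n → Matrix m n → Set
A ≈ᴹ B = ∀ i → A i ≗ B i

infixl 7 _·_
_·_ : ∀ {l m n} → Matrix l m → Matrix m n → Matrix l n
_·_ {m = m} A B i k = ∑[ j < m ] (A i j * B j k)

Invertible : ∀ {n} → Matrix n n → Set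
Invertible A = ∃[ B ] (A · B ≈ᴹ 1ᴹ × B · A ≈ᴹ 1ᴹ)

linearCombination : ∀ {k n} → Vector ℚ k → Vector (Vector ℚ n) k → Vector ℚ n
linearCombination {k} x vs j = ∑[ i < k ] (x i * vs i j)

Span : ∀ {k n} → Vector (Vector ℚ n) k → Pred (Vector ℚ n) 0ℓ
Span vs v = ∃[ x ] v ≗ linearCombination x vs

LinearlyIndependent : ∀ {k n} → Vector (Vector ℚ n) k → Set
LinearlyIndependent vs =
  ∀ x → linearCombination x vs ≗ (λ _ → 0ℚ) → x ≗ (λ _ → 0ℚ)

record IsBasis {k n} (vs : Vector (Vector ℚ n) k) (V : Pred (Vector ℚ n) 0ℓ) : Set where
  field
    members     : ∀ i → V (vs i)
    independent : LinearlyIndependent vs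
    spanning    : ∀ v → V v → Span vs v

HasDimension : ∀ {n} → Pred (Vector ℚ n) 0ℓ → ℕ → Set
HasDimension {n} V d = ∃ λ (vs : Vector (Vector ℚ n) d) → IsBasis vs V

rowSpace : ∀ {m n} → Matrix m n → Pred (Vector ℚ n) 0ℓ
rowSpace A = Span A

columnSpace : ∀ {m n} → Matrix m n → Pred (Vector ℚ m) 0ℓ
columnSpace A = Span (transpose A)

-- Any two bases of a space have the same size, so the rank is unique.
HasRank : ∀ {m n} → Matrix m n → ℕ → Set
HasRank A d = HasDimension (columnSpace A) d

-- The library has j C i = 0 for i > j.
T : ℕ → ℕ → ℚ
T i j = + (j C i) / 1

T[_,_] : ∀ {m n} → Vector ℕ m → Vector ℕ n → Matrix m n
T[ r , c ] i j = T (r i) (c j)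

StrictlyIncreasing : ∀ {k} → Vector ℕ k → Set
StrictlyIncreasing s = s Preserves Fin._<_ ⟶ _<_

Subsequence : ∀ {k l} → Vector ℕ k → Vector ℕ l → Set
Subsequence {k} {l} s t =
  ∃ λ (φ : Fin k → Fin l) → StrictlyIncreasing (toℕ ∘ φ) × s ≗ t ∘ φ

record IsOrderedSubPair {k m n} (r̂ ĉ : Vector ℕ k)
                        (r : Vector ℕ m) (c : Vector ℕ n) : Set where
  field
    rows    : Subsequence r̂ r
    columns : Subsequence ĉ c
    ordered : ∀ i → r̂ i ≤ ĉ i

record IsMaximalOrderedSubPair {k m n} (r̂ ĉ : Vector ℕ k)
                               (r : Vector ℕ m) (c : Vector ℕ n) : Set where
  field
    isOrderedSubPair : IsOrderedSubPair r̂ ĉ r c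
    maximal          : ∀ {l} (s t : Vector ℕ l) → IsOrderedSubPair s t r c → l ≤ k

IsMinimum : ∀ {n} → Pred (Fin n) 0ℓ → Pred (Fin n) 0ℓ
IsMinimum P i = P i × (∀ j → P j → i Fin.≤ j)

IsMaximum : ∀ {n} → Pred (Fin n) 0ℓ → Pred (Fin n) 0ℓ
IsMaximum P i = P i × (∀ j → P j → j Fin.≤ i)

minimum : ∀ {n} {P : Pred (Fin n) 0ℓ} → Decidable P → ∃ P → ∃ (IsMinimum P)
minimum {suc n} P? ∃P with P? zero
... | yes p₀ = zero , p₀ , λ _ _ → z≤n
minimum {suc n} P? (zero  , p) | no ¬p₀ = contradiction p ¬p₀
minimum {suc n} P? (suc i , p) | no ¬p₀ with minimum (P? ∘ suc) (i , p)
... | k , pₖ , k≤ = suc k , pₖ , λ where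
  zero    p₀ → contradiction p₀ ¬p₀
  (suc j) pⱼ → s≤s (k≤ j pⱼ)

maximum : ∀ {n} {P : Pred (Fin n) 0ℓ} → Decidable P → ∃ P → ∃ (IsMaximum P)
maximum {suc n} P? ∃P with Fin.any? (P? ∘ suc)
maximum {suc n} P? ∃P | yes ∃Pₛ with maximum (P? ∘ suc) ∃Pₛ
... | k , pₖ , ≤k = suc k , pₖ , λ where
  zero    _  → z≤n
  (suc j) pⱼ → s≤s (≤k j pⱼ)
maximum {suc n} P? (suc i , p) | no ¬∃Pₛ = contradiction (i , p) ¬∃Pₛ
maximum {suc n} P? (zero  , p) | no ¬∃Pₛ = zero , p , λ where
  zero    _  → z≤n
  (suc j) pⱼ → contradiction (j , pⱼ) ¬∃Pₛ

module Greedy {m n} (r : Vector ℕ (suc m)) (c : Vector ℕ (suc n))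
              (r↑ : StrictlyIncreasing r) (r₀≤cₙ : head r ≤ last c) where

  M-max : ∃ (IsMaximum λ i → r i ≤ last c)
  M-max = maximum (λ i → r i ≤? last c) (zero , r₀≤cₙ)

  M : Fin (suc m)
  M = proj₁ M-max

  row : Fin (suc (toℕ M)) → Fin (suc m)
  row i = inject≤ i (Fin.toℕ<n M)

  row≤M : ∀ i → row i Fin.≤ M
  row≤M i = subst (_≤ toℕ M) (sym (Fin.toℕ-inject≤ i (Fin.toℕ<n M))) (ℕ.≤-pred (Fin.toℕ<n i))

  r-row≤cₙ : ∀ i → r (row i) ≤ last c
  r-row≤cₙ i with ℕ.m≤n⇒m<n∨m≡n (row≤M i)
  ... | inj₁ i<M = ℕ.≤-trans (ℕ.<⇒≤ (r↑ i<M)) (proj₁ (proj₂ M-max))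
  ... | inj₂ i≡M = subst (λ k → r k ≤ last c) (sym (Fin.toℕ-injective i≡M)) (proj₁ (proj₂ M-max))

  first-min : ∀ i → ∃ (IsMinimum λ k → r (row i) ≤ c k)
  first-min i = minimum (λ k → r (row i) ≤? c k) (fromℕ n , r-row≤cₙ i)

  first : Fin (suc (toℕ M)) → Fin (suc n)
  first i = proj₁ (first-min i)

  -- Valued in ℕ rather than Fin (suc n), since βᵢ may exceed n.
  βℕ : (i : ℕ) → .(i ≤ toℕ M) → ℕ
  βℕ zero    _   = toℕ (first zero)
  βℕ (suc i) i<M = toℕ (first (fromℕ< (s≤s i<M))) ⊔ suc (βℕ i (ℕ.<⇒≤ i<M))

  β : Fin (suc (toℕ M)) → ℕ
  β i = βℕ (toℕ i) (ℕ.≤-pred (Fin.toℕ<n i))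

  p-max : ∃ (IsMaximum λ i → β i ≤ n)
  p-max = maximum (λ i → β i ≤? n) (zero , ℕ.≤-pred (Fin.toℕ<n (first zero)))

  p : Fin (suc (toℕ M))
  p = proj₁ p-max

  upTo-p : Fin (suc (toℕ p)) → Fin (suc (toℕ M))
  upTo-p i = inject≤ i (Fin.toℕ<n p)

  βℕ-mono-≤ : ∀ {i} j .(i≤M : i ≤ toℕ M) .(j≤M : j ≤ toℕ M) →
              i ≤ j → βℕ i i≤M ≤ βℕ j j≤M
  βℕ-mono-≤ zero _ _ z≤n = ℕ.≤-refl
  βℕ-mono-≤ (suc j) i≤M j<M i≤1+j with ℕ.m≤n⇒m<n∨m≡n i≤1+j
  ... | inj₂ refl      = ℕ.≤-refl
  ... | inj₁ (s≤s i≤j) = ℕ.≤-trans (βℕ-mono-≤ j i≤M (ℕ.<⇒≤ j<M) i≤j)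
                           (ℕ.≤-trans (ℕ.n≤1+n _) (ℕ.m≤n⊔m _ _))

  upTo-p≤p : ∀ i → upTo-p i Fin.≤ p
  upTo-p≤p i = subst (_≤ toℕ p) (sym (Fin.toℕ-inject≤ i (Fin.toℕ<n p))) (ℕ.≤-pred (Fin.toℕ<n i))

  β≤n : ∀ i → β (upTo-p i) ≤ n
  β≤n i = ℕ.≤-trans (βℕ-mono-≤ (toℕ p) _ _ (upTo-p≤p i)) (proj₁ (proj₂ p-max))

  α : Fin (suc (toℕ p)) → Fin (suc m)
  α i = row (upTo-p i)

  columnIndex : Fin (suc (toℕ p)) → Fin (suc n)
  columnIndex i = fromℕ< (s≤s (β≤n i))

  r̂ : Vector ℕ (suc (toℕ p))
  r̂ = r ∘ α

  ĉ : Vector ℕ (suc (toℕ p))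
  ĉ = c ∘ columnIndex

{-# OPTIONS --safe #-}
module Submission where

-- A combination f of the rows r̂ of T is a polynomial x ↦ Σ yᵢ (x choose r̂ᵢ). As for
-- Descartes' rule of signs, a polynomial whose first nonzero value is at s has, on
-- [s , N], at most as many weakly alternating points as it has Newton coefficients of
-- index at most N. Hence f cannot vanish at all ĉᵢ ≥ r̂ᵢ unless y = 0, so T[ r̂ , ĉ ] is
-- invertible. Where the greedy choice stops, it has used all rows before some row a and
-- all columns from some column d on, and T[ r , c ] vanishes on the rows from a and the
-- columns before d. This zero block bounds the length of ordered sub-pairs, and it forces
-- the rows r̂ to span the others.

open import Defs
open import Data.Bool using (if_then_else_)
open import Data.Fin as Fin using (Fin; zero; suc; toℕ; fromℕ<)
import Data.Fin.Properties as Fin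
import Data.Integer as ℤ
import Data.Integer.Properties as ℤ
open import Data.Nat as ℕ using (ℕ; zero; suc; _≤_; _<_; _>_; _∸_; z≤n; s≤s; z<s)
open import Data.Nat.Combinatorics using (_C_; nCk+nC[k+1]≡[n+1]C[k+1]; k>n⇒nCk≡0; nCn≡1)
import Data.Nat.Properties as ℕ
open import Data.Product using (∃-syntax; _×_; _,_; proj₁; proj₂)
open import Data.Rational as ℚ using (ℚ; 0ℚ; 1ℚ; _+_; _*_; _-_; -_)
import Data.Rational.Properties as ℚ
open import Data.Rational.Solver using (module +-*-Solver)
open import Data.Rational.Unnormalised as ℚᵘ using (mkℚᵘ; *≡*)
import Data.Rational.Unnormalised.Properties as ℚᵘ
open import Data.Sign as Sign using (Sign; opposite)
open import Data.Sum as Sum using (_⊎_; inj₁; inj₂)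
open import Data.Vec.Functional using (Vector; _∷_; head; tail; last; transpose; removeAt; insertAt)
open import Data.Vec.Functional.Properties using (insertAt-lookup; insertAt-punchIn)
open import Function using (_∘_)
open import Relation.Binary.PropositionalEquality
open import Relation.Nullary using (yes; no; does; contradiction; ¬_; ¬?)
open import Relation.Nullary.Decidable using (decidable-stable)
open import Algebra.Bundles using (CommutativeRing)
open import Algebra.Properties.Semiring.Sum
  (CommutativeRing.semiring ℚ.+-*-commutativeRing)

open +-*-Solver using (solve; _:=_; _:+_; _:*_; :-_; con)

-- Forward differences and inequalities with a sign

Δ : (ℕ → ℚ) → ℕ → ℚ
Δ f x = f (suc x) - f x

infix 4 _≤[_]_
-- The order is reversed for `Sign.-`, so that one argument serves both signs of an alternation.
_≤[_]_ : ℚ → Sign → ℚ → Set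
p ≤[ Sign.+ ] q = p ℚ.≤ q
p ≤[ Sign.- ] q = q ℚ.≤ p

≤[]-reflexive : ∀ σ {p q} → p ≡ q → p ≤[ σ ] q
≤[]-reflexive Sign.+ refl = ℚ.≤-refl
≤[]-reflexive Sign.- refl = ℚ.≤-refl

≤[]-total : ∀ σ p q → p ≤[ σ ] q ⊎ q ≤[ σ ] p
≤[]-total Sign.+ p q = ℚ.≤-total p q
≤[]-total Sign.- p q = ℚ.≤-total q p

≤[]-trans : ∀ σ {p q r} → p ≤[ σ ] q → q ≤[ σ ] r → p ≤[ σ ] r
≤[]-trans Sign.+ p≤q q≤r = ℚ.≤-trans p≤q q≤r
≤[]-trans Sign.- q≤p r≤q = ℚ.≤-trans r≤q q≤p

≤[]-opposite : ∀ σ {p q} → p ≤[ σ ] q → q ≤[ opposite σ ] p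
≤[]-opposite Sign.+ p≤q = p≤q
≤[]-opposite Sign.- q≤p = q≤p

≤[opposite]⇒≥[] : ∀ σ {p q} → p ≤[ opposite σ ] q → q ≤[ σ ] p
≤[opposite]⇒≥[] Sign.+ q≤p = q≤p
≤[opposite]⇒≥[] Sign.- p≤q = p≤q

≤[]-antisym : ∀ σ {p q} → p ≤[ σ ] q → q ≤[ σ ] p → p ≡ q
≤[]-antisym Sign.+ p≤q q≤p = ℚ.≤-antisym p≤q q≤p
≤[]-antisym Sign.- q≤p p≤q = ℚ.≤-antisym p≤q q≤p

p≤q⇒0≤q-p : ∀ {p q} → p ℚ.≤ q → 0ℚ ℚ.≤ q - p
p≤q⇒0≤q-p {p} {q} p≤q = subst (ℚ._≤ q - p) (ℚ.+-inverseʳ p) (ℚ.+-monoˡ-≤ (- p) p≤q)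

p≤q⇒p-q≤0 : ∀ {p q} → p ℚ.≤ q → p - q ℚ.≤ 0ℚ
p≤q⇒p-q≤0 {p} {q} p≤q = subst (p - q ℚ.≤_) (ℚ.+-inverseʳ q) (ℚ.+-monoˡ-≤ (- q) p≤q)

≤[]⇒0≤[]- : ∀ σ {p q} → p ≤[ σ ] q → 0ℚ ≤[ σ ] q - p
≤[]⇒0≤[]- Sign.+ p≤q = p≤q⇒0≤q-p p≤q
≤[]⇒0≤[]- Sign.- q≤p = p≤q⇒p-q≤0 q≤p

p-q≡0⇒p≡q : ∀ {p q} → p - q ≡ 0ℚ → p ≡ q
p-q≡0⇒p≡q {p} {q} p-q≡0 = begin
  p            ≡⟨ solve 2 (λ p q → p := (p :+ :- q) :+ q) refl p q ⟩
  p - q + q    ≡⟨ cong (_+ q) p-q≡0 ⟩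
  0ℚ + q       ≡⟨ ℚ.+-identityˡ q ⟩
  q            ∎
  where open ≡-Reasoning

-- Sign alternations and Newton coefficients

-- A discrete mean value argument: going back from `v`, the first value found on the `σ`-nonpositive
-- side is followed by a step in direction `σ`. The search ends at `u` at the latest.
rise : ∀ σ f {u} v → u < v → f u ≤[ σ ] 0ℚ → 0ℚ ≤[ σ ] f v →
       ∃[ t ] (u ≤ t × t < v × 0ℚ ≤[ σ ] Δ f t)
rise σ f {u} (suc v) (s≤s u≤v) fu≤0 0≤fv with ≤[]-total σ (f v) 0ℚ
... | inj₁ fv≤0 = v , u≤v , ℕ.≤-refl , ≤[]⇒0≤[]- σ (≤[]-trans σ fv≤0 0≤fv)
... | inj₂ 0≤fv′ with ℕ.m≤n⇒m<n∨m≡n u≤v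
...   | inj₂ refl = v , u≤v , ℕ.≤-refl , ≤[]⇒0≤[]- σ (≤[]-trans σ fu≤0 0≤fv)
...   | inj₁ u<v with rise σ f v u<v fu≤0 0≤fv′
...     | t , u≤t , t<v , rises = t , u≤t , ℕ.m<n⇒m<1+n t<v , rises

-- Alternates f N σ u l: the values of f at some l points of [u , N] have weakly
-- alternating signs, the first one being σ; zeros of f count for either sign.
data Alternates (f : ℕ → ℚ) (N : ℕ) : Sign → ℕ → ℕ → Set where
  []   : ∀ {σ u} → Alternates f N σ u 0
  cons : ∀ {σ u l} c → u ≤ c → c ≤ N → 0ℚ ≤[ σ ] f c →
         Alternates f N (opposite σ) (suc c) l → Alternates f N σ u (suc l)

weaken : ∀ {f N σ u v l} → u ≤ v → Alternates f N σ v l → Alternates f N σ u l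
weaken u≤v []                     = []
weaken u≤v (cons c v≤c c≤N fc as) = cons c (ℕ.≤-trans u≤v v≤c) c≤N fc as

-- Between two consecutive points of the alternation the differences have a sum of known sign.
Δ-alternates : ∀ {f N} σ {c l} → 0ℚ ≤[ σ ] f c →
               Alternates f (suc N) (opposite σ) (suc c) l →
               Alternates (Δ f) N (opposite σ) c l
Δ-alternates σ fc [] = []
Δ-alternates {f} σ fc (cons d c<d d≤N fd as)
  with rise (opposite σ) f d c<d (≤[]-opposite σ fc) fd
... | t , c≤t , t<d , rises =
  cons t c≤t (ℕ.≤-pred (ℕ.≤-trans t<d d≤N)) rises (weaken t<d (Δ-alternates (opposite σ) fd as))

nonzero : ℚ → ℕ
nonzero q = if does (q ℚ.≟ 0ℚ) then 0 else 1

nonzero-0 : ∀ {q} → q ≡ 0ℚ → nonzero q ≡ 0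
nonzero-0 refl = refl

nonzero-1 : ∀ {q} → q ≢ 0ℚ → nonzero q ≡ 1
nonzero-1 {q} q≢0 with q ℚ.≟ 0ℚ
... | yes q≡0 = contradiction q≡0 q≢0
... | no  _   = refl

nonzero≤1 : ∀ q → nonzero q ≤ 1
nonzero≤1 q with q ℚ.≟ 0ℚ
... | yes _ = z≤n
... | no  _ = s≤s z≤n

-- The number of nonzero coefficients of index at most N in the Newton expansion of f.
terms : ℕ → (ℕ → ℚ) → ℕ
terms zero    f = nonzero (f 0)
terms (suc N) f = nonzero (f 0) ℕ.+ terms N (Δ f)

firstNonzero : ∀ (f : ℕ → ℚ) n → (∀ x → x < n → f x ≡ 0ℚ) ⊎
               ∃[ s ] (s < n × f s ≢ 0ℚ × (∀ x → x < s → f x ≡ 0ℚ))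
firstNonzero f zero = inj₁ λ _ ()
firstNonzero f (suc n) with firstNonzero f n
... | inj₂ (s , s<n , fs≢0 , f≡0) = inj₂ (s , ℕ.m<n⇒m<1+n s<n , fs≢0 , f≡0)
... | inj₁ f≡0 with f n ℚ.≟ 0ℚ
...   | no fn≢0 = inj₂ (n , ℕ.≤-refl , fn≢0 , f≡0)
...   | yes fn≡0 = inj₁ λ x x<1+n → case x (ℕ.m≤n⇒m<n∨m≡n (ℕ.≤-pred x<1+n))
  where
  case : ∀ x → x < n ⊎ x ≡ n → f x ≡ 0ℚ
  case x (inj₁ x<n)  = f≡0 x x<n
  case x (inj₂ refl) = fn≡0

Δ≡0⇒constant : ∀ f n → (∀ x → x < n → Δ f x ≡ 0ℚ) → ∀ x → x ≤ n → f x ≡ f 0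
Δ≡0⇒constant f n Δf≡0 zero    _   = refl
Δ≡0⇒constant f n Δf≡0 (suc x) x<n =
  trans (p-q≡0⇒p≡q (Δf≡0 x x<n)) (Δ≡0⇒constant f n Δf≡0 x (ℕ.<⇒≤ x<n))

-- Replacing f by Δ f removes one sign alternation when f 0 ≢ 0, and none otherwise
-- because the zero of f just before s can be prepended to the alternation.
alternates⇒length≤terms : ∀ N f s {σ l} → (∀ x → x < s → f x ≡ 0ℚ) → f s ≢ 0ℚ →
                          Alternates f N σ s l → l ≤ terms N f
alternates⇒length≤terms N f s f≡0 fs≢0 [] = z≤n
alternates⇒length≤terms zero f zero f≡0 fs≢0 (cons c _ c≤0 _ []) =
  ℕ.≤-reflexive (sym (nonzero-1 fs≢0))
alternates⇒length≤terms zero f s f≡0 fs≢0 (cons c _ z≤n _ (cons d (s≤s _) () _ _))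
alternates⇒length≤terms zero f (suc s) f≡0 fs≢0 (cons c s<c c≤0 _ [])
  with () ← ℕ.≤-trans s<c c≤0
alternates⇒length≤terms (suc N) f (suc s) {σ} {l} f≡0 fs≢0 as =
  subst (λ k → l ≤ k ℕ.+ terms N (Δ f)) (sym (nonzero-0 (f≡0 0 z<s)))
    (alternates⇒length≤terms N (Δ f) s below at (Δ-alternates (opposite σ)
      (≤[]-reflexive (opposite σ) (sym (f≡0 s ℕ.≤-refl)))
      (subst (λ τ → Alternates f (suc N) τ (suc s) l) (opposite² σ) as)))
  where
  opposite² : ∀ σ → σ ≡ opposite (opposite σ)
  opposite² Sign.+ = refl
  opposite² Sign.- = refl
  below : ∀ x → x < s → Δ f x ≡ 0ℚ
  below x x<s = cong₂ _-_ (f≡0 (suc x) (s≤s x<s)) (f≡0 x (ℕ.m<n⇒m<1+n x<s))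
  at : Δ f s ≢ 0ℚ
  at Δfs≡0 = fs≢0 (trans (p-q≡0⇒p≡q Δfs≡0) (f≡0 s ℕ.≤-refl))
alternates⇒length≤terms (suc N) f zero {σ} {suc l} f≡0 f0≢0 (cons c _ c≤N fc as) =
  subst (λ k → suc l ≤ k ℕ.+ terms N (Δ f)) (sym (nonzero-1 f0≢0)) (s≤s (tail≤ as))
  where
  incompatible : ∀ {x y} → f x ≡ f 0 → f y ≡ f 0 →
                 0ℚ ≤[ σ ] f x → ¬ 0ℚ ≤[ opposite σ ] f y
  incompatible {x} {y} fx≡f0 fy≡f0 fx fy = f0≢0 (trans (sym fx≡f0) (sym (≤[]-antisym σ fx
    (subst (_≤[ σ ] 0ℚ) (trans fy≡f0 (sym fx≡f0)) (≤[opposite]⇒≥[] σ fy)))))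

  tail≤ : ∀ {l} → Alternates f (suc N) (opposite σ) (suc c) l → l ≤ terms N (Δ f)
  tail≤ [] = z≤n
  -- Up to the first nonzero difference, `f` is the nonzero constant `f 0`, so `c` and `d`, which
  -- carry opposite signs, cannot both lie in that range.
  tail≤ as@(cons d c<d d≤N fd ds) with firstNonzero (Δ f) (suc N)
  ... | inj₁ Δf≡0 = contradiction fd (incompatible (constant c c≤N) (constant d d≤N) fc)
    where constant = Δ≡0⇒constant f (suc N) Δf≡0
  ... | inj₂ (s , s≤N , Δfs≢0 , Δf≡0) with s ℕ.≤? c | d ℕ.≤? s
  ...   | yes s≤c | _ = alternates⇒length≤terms N (Δ f) s Δf≡0 Δfs≢0
                          (weaken s≤c (Δ-alternates σ fc as))
  ...   | no s≰c | yes d≤s = contradiction fd (incompatible (constant c c≤s) (constant d d≤s) fc)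
    where
    constant = Δ≡0⇒constant f s Δf≡0
    c≤s = ℕ.<⇒≤ (ℕ.≰⇒> s≰c)
  -- Here `c < s < d`. By constancy `f s` has the sign of `f c`, so `s` replaces `c` as the first
  -- point.
  ...   | no s≰c | no d≰s = alternates⇒length≤terms N (Δ f) s Δf≡0 Δfs≢0
                          (Δ-alternates σ fs (cons d (ℕ.≰⇒> d≰s) d≤N fd ds))
    where
    constant = Δ≡0⇒constant f s Δf≡0
    fs : 0ℚ ≤[ σ ] f s
    fs = subst (0ℚ ≤[ σ ]_) (trans (constant c (ℕ.<⇒≤ (ℕ.≰⇒> s≰c))) (sym (constant s ℕ.≤-refl))) fc

-- Pascal's rule for the entries of `T`

-- Passing to unnormalised fractions turns the claim into an identity of integers over the
-- denominator 1.
+-homo-/1 : ∀ a b → (ℤ.+ (a ℕ.+ b)) ℚ./ 1 ≡ (ℤ.+ a) ℚ./ 1 + (ℤ.+ b) ℚ./ 1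
+-homo-/1 a b = ℚ.toℚᵘ-injective (begin
  ℚ.toℚᵘ ((ℤ.+ (a ℕ.+ b)) ℚ./ 1)                    ≈⟨ ℚ.toℚᵘ-fromℚᵘ _ ⟩
  mkℚᵘ (ℤ.+ (a ℕ.+ b)) 0                            ≈⟨ *≡* (cong (ℤ._* ℤ.1ℤ) (cong₂ ℤ._+_ (sym (ℤ.*-identityʳ (ℤ.+ a))) (sym (ℤ.*-identityʳ (ℤ.+ b))))) ⟩
  mkℚᵘ (ℤ.+ a) 0 ℚᵘ.+ mkℚᵘ (ℤ.+ b) 0                  ≈⟨ ℚᵘ.+-cong (ℚ.toℚᵘ-fromℚᵘ (mkℚᵘ (ℤ.+ a) 0)) (ℚ.toℚᵘ-fromℚᵘ (mkℚᵘ (ℤ.+ b) 0)) ⟨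
  ℚ.toℚᵘ ((ℤ.+ a) ℚ./ 1) ℚᵘ.+ ℚ.toℚᵘ ((ℤ.+ b) ℚ./ 1)  ≈⟨ ℚ.toℚᵘ-homo-+ ((ℤ.+ a) ℚ./ 1) ((ℤ.+ b) ℚ./ 1) ⟨
  ℚ.toℚᵘ ((ℤ.+ a) ℚ./ 1 + (ℤ.+ b) ℚ./ 1)              ∎)
  where open ℚᵘ.≃-Reasoning

T-pascal : ∀ i j → T i j + T (suc i) j ≡ T (suc i) (suc j)
T-pascal i j = trans (sym (+-homo-/1 (j C i) (j C suc i)))
                     (cong (λ a → (ℤ.+ a) ℚ./ 1) (nCk+nC[k+1]≡[n+1]C[k+1] j i))

-- Pascal's rule in the form used below: differencing shifts the Newton basis down by one index.
ΔT : ∀ i j → Δ (T (suc i)) j ≡ T i j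
ΔT i j = trans (cong (_- T (suc i) j) (sym (T-pascal i j)))
  (solve 2 (λ p q → (p :+ q) :+ :- q := p) refl (T i j) (T (suc i) j))

j<i⇒Tij≡0 : ∀ {i j} → j < i → T i j ≡ 0ℚ
j<i⇒Tij≡0 j<i = cong (λ a → (ℤ.+ a) ℚ./ 1) (k>n⇒nCk≡0 j<i)

Tii≡1 : ∀ i → T i i ≡ 1ℚ
Tii≡1 i = cong (λ a → (ℤ.+ a) ℚ./ 1) (nCn≡1 i)

-- Newton polynomials and their differences

sum-zero : ∀ {n} (f : Vector ℚ n) → (∀ i → f i ≡ 0ℚ) → sum f ≡ 0ℚ
sum-zero {n} f f≡0 = trans (sum-cong-≗ f≡0) (sum-replicate-zero n)

sum-minus : ∀ {n} (f g : Vector ℚ n) → sum f - sum g ≡ ∑[ i < n ] (f i - g i)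
sum-minus {zero}  f g = refl
sum-minus {suc n} f g = trans
  (solve 4 (λ a b c d → (a :+ b) :+ :- (c :+ d) := (a :+ :- c) :+ (b :+ :- d)) refl
     (f zero) (sum (tail f)) (g zero) (sum (tail g)))
  (cong ((f zero - g zero) +_) (sum-minus (tail f) (tail g)))

opaque
  -- Opaque, so that goals keep this form; `newton-suc` and `newton≡sum` give access to the sum.
  newton : ∀ {k} → Vector ℚ k → Vector ℕ k → ℕ → ℚ
  newton {k} y r x = ∑[ i < k ] (y i * T (r i) x)

  newton-suc : ∀ {k} (y : Vector ℚ (suc k)) r x →
               newton y r x ≡ y zero * T (r zero) x + newton (tail y) (tail r) x
  newton-suc y r x = refl

  newton≡sum : ∀ {k} (y : Vector ℚ k) r x → newton y r x ≡ ∑[ i < k ] (y i * T (r i) x)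
  newton≡sum y r x = refl

  newton-zero : ∀ {k} (y : Vector ℚ k) r x → (∀ i → x < r i ⊎ y i ≡ 0ℚ) → newton y r x ≡ 0ℚ
  newton-zero y r x absent = sum-zero _ λ i → term i (absent i)
    where
    term : ∀ i → x < r i ⊎ y i ≡ 0ℚ → y i * T (r i) x ≡ 0ℚ
    term i (inj₁ x<rᵢ) = trans (cong (y i *_) (j<i⇒Tij≡0 x<rᵢ)) (ℚ.*-zeroʳ (y i))
    term i (inj₂ yᵢ≡0) = trans (cong (_* T (r i) x) yᵢ≡0) (ℚ.*-zeroˡ (T (r i) x))

  Δ-newton : ∀ {k} (y : Vector ℚ k) r → (∀ i → 0 < r i) →
             Δ (newton y r) ≗ newton y (ℕ.pred ∘ r)
  Δ-newton y r r>0 x = trans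
    (sum-minus (λ i → y i * T (r i) (suc x)) (λ i → y i * T (r i) x))
    (sum-cong-≗ λ i → term i (r>0 i))
    where
    open ≡-Reasoning
    term : ∀ i → 0 < r i → y i * T (r i) (suc x) - y i * T (r i) x ≡ y i * T (ℕ.pred (r i)) x
    term i rᵢ>0 with r i | rᵢ>0
    ... | suc s | _ = begin
      y i * T (suc s) (suc x) - y i * T (suc s) x
        ≡⟨ solve 3 (λ y a b → y :* a :+ :- (y :* b) := y :* (a :+ :- b)) refl
             (y i) (T (suc s) (suc x)) (T (suc s) x) ⟩
      y i * Δ (T (suc s)) x
        ≡⟨ cong (y i *_) (ΔT s x) ⟩
      y i * T s x ∎

  -- The term of index 0 is constant and cancels in the difference; the other indices drop by one.
  Δ-newton-0 : ∀ {k} (y : Vector ℚ (suc k)) r → head r ≡ 0 → (∀ i → 0 < r (suc i)) →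
               Δ (newton y r) ≗ newton (tail y) (ℕ.pred ∘ tail r)
  Δ-newton-0 y r r₀≡0 r>0 x rewrite r₀≡0 = trans
    (solve 4 (λ y a b c → (y :* con 1ℚ :+ b) :+ :- (y :* con 1ℚ :+ c) := b :+ :- c) refl
      (y zero) 0ℚ (newton (tail y) (tail r) (suc x)) (newton (tail y) (tail r) x))
    (Δ-newton (tail y) (tail r) r>0 x)

-- Counting terms and zeros of Newton polynomials

strictlyIncreasing⇒monotone : ∀ {k} {s : Vector ℕ k} → StrictlyIncreasing s →
                              ∀ {i j} → i Fin.≤ j → s i ≤ s j
strictlyIncreasing⇒monotone s↑ {i} {j} i≤j with ℕ.m≤n⇒m<n∨m≡n i≤j
... | inj₁ i<j = ℕ.<⇒≤ (s↑ i<j)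
... | inj₂ i≡j = ℕ.≤-reflexive (cong _ (Fin.toℕ-injective i≡j))

terms-zero : ∀ N f → (∀ x → x ≤ N → f x ≡ 0ℚ) → terms N f ≡ 0
terms-zero zero    f f≡0 = nonzero-0 (f≡0 0 z≤n)
terms-zero (suc N) f f≡0 = cong₂ ℕ._+_ (nonzero-0 (f≡0 0 z≤n))
  (terms-zero N (Δ f) λ x x≤N → cong₂ _-_ (f≡0 (suc x) (s≤s x≤N)) (f≡0 x (ℕ.m≤n⇒m≤1+n x≤N)))

pred-increasing : ∀ {k} {r : Vector ℕ k} → StrictlyIncreasing r → (∀ i → 0 < r i) →
                  StrictlyIncreasing (ℕ.pred ∘ r)
pred-increasing r↑ r>0 {i} i<j = ℕ.pred-mono-< {{ℕ.>-nonZero (r>0 i)}} (r↑ i<j)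

tail-increasing : ∀ {k} {r : Vector ℕ (suc k)} → StrictlyIncreasing r → StrictlyIncreasing (tail r)
tail-increasing r↑ i<j = r↑ (s≤s i<j)

-- Each difference lowers the indices by one and uses up the head when its index is 0, so `terms`
-- counts at most the indices up to `N`, which sit at positions before `a`. Pointwise equality with
-- `f` lets the recursion pass to `Δ f`.
terms-newton≤ : ∀ N a {k} (y : Vector ℚ k) r → StrictlyIncreasing r →
                (∀ i → a ≤ toℕ i → N < r i) → ∀ {f} → f ≗ newton y r → terms N f ≤ a
terms-newton≤ N zero y r r↑ N<r {f} f≗ = ℕ.≤-reflexive (terms-zero N f λ x x≤N →
  trans (f≗ x) (newton-zero y r x λ i → inj₁ (ℕ.≤-<-trans x≤N (N<r i z≤n))))
terms-newton≤ N (suc a) {zero} y r r↑ N<r {f} f≗ =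
  ℕ.≤-trans (ℕ.≤-reflexive (terms-zero N f λ x _ → trans (f≗ x) (newton-zero y r x λ ()))) z≤n
terms-newton≤ zero (suc a) {suc k} y r r↑ N<r {f} f≗ = ℕ.≤-trans (nonzero≤1 (f 0)) (s≤s z≤n)
terms-newton≤ (suc N) (suc a) {suc k} y r r↑ N<r {f} f≗ with r zero ℕ.≟ 0
... | yes r₀≡0 = ℕ.+-mono-≤ (nonzero≤1 (f 0))
  (terms-newton≤ N a (tail y) (ℕ.pred ∘ tail r)
    (pred-increasing {r = tail r} (tail-increasing {r = r} r↑) r>0)
    (λ i a≤i → ℕ.pred-mono-≤ (N<r (suc i) (s≤s a≤i)))
    λ x → trans (cong₂ _-_ (f≗ (suc x)) (f≗ x)) (Δ-newton-0 y r r₀≡0 r>0 x))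
  where
  r>0 : ∀ i → 0 < r (suc i)
  r>0 i = ℕ.≤-<-trans z≤n (r↑ {zero} {suc i} z<s)
... | no r₀≢0 = subst (λ n → n ℕ.+ terms N (Δ f) ≤ suc a)
  (sym (nonzero-0 (trans (f≗ 0) (newton-zero y r 0 (inj₁ ∘ r>0)))))
  (terms-newton≤ N (suc a) y (ℕ.pred ∘ r) (pred-increasing {r = r} r↑ r>0)
    (λ i a≤i → ℕ.pred-mono-≤ (N<r i a≤i))
    λ x → trans (cong₂ _-_ (f≗ (suc x)) (f≗ x)) (Δ-newton y r r>0 x))
  where
  r>0 : ∀ i → 0 < r i
  r>0 i = ℕ.<-≤-trans (ℕ.n≢0⇒n>0 r₀≢0) (strictlyIncreasing⇒monotone r↑ z≤n)

zeros⇒alternates : ∀ a {k} (c : Vector ℕ k) → StrictlyIncreasing c → ∀ {f N σ u} → a ≤ k →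
                   (∀ l → toℕ l < a → u ≤ c l × c l ≤ N × f (c l) ≡ 0ℚ) →
                   Alternates f N σ u a
zeros⇒alternates zero c c↑ a≤k zeros = []
zeros⇒alternates (suc a) {suc k} c c↑ {σ = σ} (s≤s a≤k) zeros with zeros zero z<s
... | u≤c , c≤N , fc≡0 = cons (c zero) u≤c c≤N (≤[]-reflexive σ (sym fc≡0))
  (zeros⇒alternates a (tail c) (tail-increasing {r = c} c↑) a≤k λ l l<a →
    c↑ z<s , proj₂ (zeros (suc l) (s≤s l<a)))

-- A Newton polynomial with y₀ ≢ 0 would have the a + 2 alternating points
-- r₀ , c₀ , … , cₐ but only a + 1 terms of index at most cₐ.
head≡0 : ∀ a {k} (y : Vector ℚ (suc k)) r c → StrictlyIncreasing r → StrictlyIncreasing c →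
         a < suc k → r zero ≤ c zero →
         (∀ i l → toℕ l < suc a → suc a ≤ toℕ i → c l < r i) →
         (∀ l → toℕ l < suc a → newton y r (c l) ≡ 0ℚ) → y zero ≡ 0ℚ
head≡0 a {k} y r c r↑ c↑ a<k r₀≤c₀ c<r f≡0 with y zero ℚ.≟ 0ℚ
... | yes y₀≡0 = y₀≡0
... | no  y₀≢0 = contradiction (ℕ.≤-trans (alternates sign) few) ℕ.1+n≰n
  where
  f = newton y r
  N = c (fromℕ< a<k)

  f[r₀]≡y₀ : f (r zero) ≡ y zero
  f[r₀]≡y₀ = trans (newton-suc y r (r zero)) (trans (cong₂ _+_
    (trans (cong (y zero *_) (Tii≡1 (r zero))) (ℚ.*-identityʳ (y zero)))
    (newton-zero (tail y) (tail r) (r zero) λ i → inj₁ (r↑ {zero} {suc i} z<s)))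
    (ℚ.+-identityʳ (y zero)))

  f[r₀]≢0 : f (r zero) ≢ 0ℚ
  f[r₀]≢0 f≡0 = y₀≢0 (trans (sym f[r₀]≡y₀) f≡0)

  -- The polynomial is nonzero at `r zero` and zero at `c zero`, so the points differ and `r zero`
  -- can precede the zeros in the alternation.
  r₀<c₀ : r zero < c zero
  r₀<c₀ = ℕ.≤∧≢⇒< r₀≤c₀ λ r₀≡c₀ → f[r₀]≢0 (trans (cong f r₀≡c₀) (f≡0 zero z<s))

  c≤N : ∀ l → toℕ l < suc a → c l ≤ N
  c≤N l l≤a = strictlyIncreasing⇒monotone c↑
    (subst (toℕ l ≤_) (sym (Fin.toℕ-fromℕ< a<k)) (ℕ.≤-pred l≤a))

  few : terms N f ≤ suc a
  few = terms-newton≤ N (suc a) y r r↑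
    (λ i → c<r i (fromℕ< a<k) (ℕ.≤-reflexive (cong suc (Fin.toℕ-fromℕ< a<k)))) λ _ → refl

  sign : 0ℚ ≤[ Sign.+ ] f (r zero) ⊎ 0ℚ ≤[ Sign.- ] f (r zero)
  sign = ≤[]-total Sign.+ 0ℚ (f (r zero))

  points : ∀ σ → 0ℚ ≤[ σ ] f (r zero) → suc (suc a) ≤ terms N f
  points σ f[r₀] = alternates⇒length≤terms N f (r zero)
    (λ x x<r₀ → newton-zero y r x λ i →
      inj₁ (ℕ.<-≤-trans x<r₀ (strictlyIncreasing⇒monotone r↑ {zero} {i} z≤n)))
    f[r₀]≢0
    (cons (r zero) ℕ.≤-refl (ℕ.≤-trans r₀≤c₀ (c≤N zero z<s)) f[r₀]
      (zeros⇒alternates (suc a) c c↑ a<k λ l l≤a →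
        ℕ.<-≤-trans r₀<c₀ (strictlyIncreasing⇒monotone c↑ {zero} {l} z≤n) , c≤N l l≤a , f≡0 l l≤a))

  alternates : _ → suc (suc a) ≤ terms N f
  alternates (inj₁ f[r₀]) = points Sign.+ f[r₀]
  alternates (inj₂ f[r₀]) = points Sign.- f[r₀]

-- Once `head≡0` has cleared the first coefficient, the polynomial of the tails takes the same
-- values and the hypotheses pass to the tails. The case `a = k` gives independence of the rows; a
-- smaller `a` clears the coefficients before a zero block.
prefix≡0 : ∀ a {k} (y : Vector ℚ k) r c → StrictlyIncreasing r → StrictlyIncreasing c →
           (∀ i → r i ≤ c i) → a ≤ k →
           (∀ i l → toℕ l < a → a ≤ toℕ i → c l < r i) →
           (∀ l → toℕ l < a → newton y r (c l) ≡ 0ℚ) → ∀ l → toℕ l < a → y l ≡ 0ℚ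
prefix≡0 (suc a) {suc k} y r c r↑ c↑ r≤c (s≤s a≤k) c<r f≡0 = λ where
    zero    _         → y₀≡0
    (suc l) (s≤s l<a) → prefix≡0 a (tail y) (tail r) (tail c)
      (tail-increasing {r = r} r↑) (tail-increasing {r = c} c↑) (r≤c ∘ suc) a≤k
      (λ i l l<a a≤i → c<r (suc i) (suc l) (s≤s l<a) (s≤s a≤i))
      (λ l l<a → trans (sym (drop-head (c (suc l)))) (f≡0 (suc l) (s≤s l<a)))
      l l<a
  where
  y₀≡0 = head≡0 a y r c r↑ c↑ (s≤s a≤k) (r≤c zero) c<r f≡0
  drop-head : ∀ x → newton y r x ≡ newton (tail y) (tail r) x
  drop-head x = trans (newton-suc y r x) (trans (cong (_+ newton (tail y) (tail r) x)
    (trans (cong (_* T (r zero) x) y₀≡0) (ℚ.*-zeroˡ (T (r zero) x))))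
    (ℚ.+-identityˡ (newton (tail y) (tail r) x)))

-- Linear combinations, dependence and inverses

linearCombination-congˡ : ∀ {k n} {x y : Vector ℚ k} (vs : Matrix k n) → x ≗ y →
                          linearCombination x vs ≗ linearCombination y vs
linearCombination-congˡ vs x≗y j = sum-cong-≗ λ i → cong (_* vs i j) (x≗y i)

linearCombination-congʳ : ∀ {k n} (x : Vector ℚ k) {vs ws : Matrix k n} → vs ≈ᴹ ws →
                          linearCombination x vs ≗ linearCombination x ws
linearCombination-congʳ x vs≈ws j = sum-cong-≗ λ i → cong (x i *_) (vs≈ws i j)

linearCombination-assoc : ∀ {k l n} (x : Vector ℚ k) (A : Matrix k l) (B : Matrix l n) →
  linearCombination (linearCombination x A) B ≗ linearCombination x (A · B)
linearCombination-assoc {k} {l} x A B j = begin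
  ∑[ q < l ] ((∑[ i < k ] (x i * A i q)) * B q j)
    ≡⟨ sum-cong-≗ (λ q → *-distribʳ-sum (B q j) (λ i → x i * A i q)) ⟩
  ∑[ q < l ] (∑[ i < k ] (x i * A i q * B q j))
    ≡⟨ ∑-comm (λ q i → x i * A i q * B q j) ⟩
  ∑[ i < k ] (∑[ q < l ] (x i * A i q * B q j))
    ≡⟨ sum-cong-≗ (λ i → sum-cong-≗ λ q → ℚ.*-assoc (x i) (A i q) (B q j)) ⟩
  ∑[ i < k ] (∑[ q < l ] (x i * (A i q * B q j)))
    ≡⟨ sum-cong-≗ (λ i → *-distribˡ-sum (x i) (λ q → A i q * B q j)) ⟨
  ∑[ i < k ] (x i * (∑[ q < l ] (A i q * B q j))) ∎
  where open ≡-Reasoning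

1ᴹ-diagonal : ∀ {n} (i : Fin n) → 1ᴹ i i ≡ 1ℚ
1ᴹ-diagonal i with i Fin.≟ i
... | yes _  = refl
... | no i≢i = contradiction refl i≢i

1ᴹ-offDiagonal : ∀ {n} {i j : Fin n} → i ≢ j → 1ᴹ i j ≡ 0ℚ
1ᴹ-offDiagonal {i = i} {j} i≢j with i Fin.≟ j
... | yes i≡j = contradiction i≡j i≢j
... | no _    = refl

sum-single : ∀ {n} (f : Vector ℚ n) i → (∀ j → j ≢ i → f j ≡ 0ℚ) → sum f ≡ f i
sum-single {suc n} f i f≡0 = begin
  sum f                     ≡⟨ sum-remove {i = i} f ⟩
  f i + sum (removeAt f i)  ≡⟨ cong (f i +_) (sum-zero _ λ j → f≡0 (Fin.punchIn i j) (Fin.punchInᵢ≢i i j)) ⟩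
  f i + 0ℚ                  ≡⟨ ℚ.+-identityʳ (f i) ⟩
  f i                       ∎
  where open ≡-Reasoning

linearCombination-unit : ∀ {k n} i (vs : Matrix k n) → linearCombination (1ᴹ i) vs ≗ vs i
linearCombination-unit i vs j = trans
  (sum-single (λ q → 1ᴹ i q * vs q j) i λ q q≢i →
    trans (cong (_* vs q j) (1ᴹ-offDiagonal (q≢i ∘ sym))) (ℚ.*-zeroˡ (vs q j)))
  (trans (cong (_* vs i j) (1ᴹ-diagonal i)) (ℚ.*-identityˡ (vs i j)))

linearCombination-1ᴹ : ∀ {k} (x : Vector ℚ k) → linearCombination x 1ᴹ ≗ x
linearCombination-1ᴹ x j = trans
  (sum-single (λ q → x q * 1ᴹ q j) j λ q q≢j →
    trans (cong (x q *_) (1ᴹ-offDiagonal q≢j)) (ℚ.*-zeroʳ (x q)))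
  (trans (cong (x j *_) (1ᴹ-diagonal j)) (ℚ.*-identityʳ (x j)))

member : ∀ {k n} (vs : Matrix k n) i → Span vs (vs i)
member vs i = 1ᴹ i , λ j → sym (linearCombination-unit i vs j)

span-trans : ∀ {k l n} {vs : Matrix k n} {ws : Matrix l n} → (∀ i → Span vs (ws i)) →
             ∀ {v} → Span ws v → Span vs v
span-trans {vs = vs} {ws} ws⊆vs (x , v≗) =
  linearCombination x (proj₁ ∘ ws⊆vs) , λ j → trans (v≗ j)
    (trans (linearCombination-congʳ x (proj₂ ∘ ws⊆vs) j)
           (sym (linearCombination-assoc x (proj₁ ∘ ws⊆vs) vs j)))

linearCombination-minus : ∀ {k n} (x y : Vector ℚ k) (vs : Matrix k n) j →
  linearCombination (λ i → x i - y i) vs j ≡ linearCombination x vs j - linearCombination y vs j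
linearCombination-minus x y vs j = trans
  (sum-cong-≗ λ i → solve 3 (λ x y v → (x :+ :- y) :* v := x :* v :+ :- (y :* v)) refl
                      (x i) (y i) (vs i j))
  (sym (sum-minus (λ i → x i * vs i j) (λ i → y i * vs i j)))

independent⇒injective : ∀ {k n} {vs : Matrix k n} → LinearlyIndependent vs → ∀ {x y} →
                        linearCombination x vs ≗ linearCombination y vs → x ≗ y
independent⇒injective {vs = vs} ind {x} {y} eq i = p-q≡0⇒p≡q (ind (λ i → x i - y i)
  (λ j → trans (linearCombination-minus x y vs j) (trans
    (cong (_- linearCombination y vs j) (eq j)) (ℚ.+-inverseʳ (linearCombination y vs j)))) i)

-- Gaussian elimination of the first coordinate, with a pivot vs i.
dependent : ∀ k (vs : Matrix (suc k) k) →
            ∃[ x ] ((∃[ i ] x i ≢ 0ℚ) × linearCombination x vs ≗ (λ _ → 0ℚ))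
dependent zero vs = (λ _ → 1ℚ) , (zero , λ ()) , λ ()
dependent (suc k) vs with Fin.any? (λ i → ¬? (vs i zero ℚ.≟ 0ℚ))
... | no ∄pivot with dependent k (λ i → tail (vs (suc i)))
...   | x , (i , xᵢ≢0) , eq = (0ℚ ∷ x) , (suc i , xᵢ≢0) , λ where
        zero    → sum-zero _ λ i → trans (cong ((0ℚ ∷ x) i *_) (column≡0 i)) (ℚ.*-zeroʳ ((0ℚ ∷ x) i))
        (suc j) → trans (cong₂ _+_ (ℚ.*-zeroˡ (vs zero (suc j))) (eq j)) (ℚ.+-identityˡ 0ℚ)
  where
  column≡0 : ∀ i → vs i zero ≡ 0ℚ
  column≡0 i = decidable-stable (vs i zero ℚ.≟ 0ℚ) λ ≢0 → ∄pivot (i , ≢0)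
dependent (suc k) vs | yes (i , pivot≢0) = eliminated (dependent k ws)
  where
  open ≡-Reasoning
  instance _ = ℚ.≢-nonZero pivot≢0
  d : Vector ℚ (suc k)
  d j = vs (Fin.punchIn i j) zero * ℚ.1/ vs i zero
  ws : Matrix (suc k) k
  ws j q = vs (Fin.punchIn i j) (suc q) - d j * vs i (suc q)

  eliminated : ∃[ x ] ((∃[ i ] x i ≢ 0ℚ) × linearCombination x ws ≗ (λ _ → 0ℚ)) →
               ∃[ x ] ((∃[ i ] x i ≢ 0ℚ) × linearCombination x vs ≗ (λ _ → 0ℚ))
  eliminated (x , (j , xⱼ≢0) , eq) =
    y , (Fin.punchIn i j , λ yⱼ≡0 → xⱼ≢0 (trans (sym (insertAt-punchIn x i _ j)) yⱼ≡0)) , λ where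
      zero    → trans (combination zero) (sum-zero _ λ j →
        trans (cong (λ q → x j * (vs (Fin.punchIn i j) zero - q)) (pivot j))
          (trans (cong (x j *_) (ℚ.+-inverseʳ (vs (Fin.punchIn i j) zero))) (ℚ.*-zeroʳ (x j))))
      (suc q) → trans (combination (suc q)) (eq q)
    where
    -- The coefficient `- e` of the pivot vector accounts for the multiples `d j` of it subtracted
    -- in `ws`.
    e : ℚ
    e = ∑[ j < suc k ] (x j * d j)
    y : Vector ℚ (suc (suc k))
    y = insertAt x i (- e)

    pivot : ∀ j → d j * vs i zero ≡ vs (Fin.punchIn i j) zero
    pivot j = begin
      vs (Fin.punchIn i j) zero * ℚ.1/ vs i zero * vs i zero
        ≡⟨ ℚ.*-assoc (vs (Fin.punchIn i j) zero) (ℚ.1/ vs i zero) (vs i zero) ⟩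
      vs (Fin.punchIn i j) zero * (ℚ.1/ vs i zero * vs i zero)
        ≡⟨ cong (vs (Fin.punchIn i j) zero *_) (ℚ.*-inverseˡ (vs i zero)) ⟩
      vs (Fin.punchIn i j) zero * 1ℚ
        ≡⟨ ℚ.*-identityʳ (vs (Fin.punchIn i j) zero) ⟩
      vs (Fin.punchIn i j) zero ∎

    combination : ∀ q → linearCombination y vs q ≡
                  ∑[ j < suc k ] (x j * (vs (Fin.punchIn i j) q - d j * vs i q))
    combination q = begin
      linearCombination y vs q
        ≡⟨ sum-remove {i = i} (λ j → y j * vs j q) ⟩
      y i * vs i q + ∑[ j < suc k ] (y (Fin.punchIn i j) * vs (Fin.punchIn i j) q)
        ≡⟨ cong₂ _+_ (cong (_* vs i q) (insertAt-lookup x i (- e)))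
             (sum-cong-≗ λ j → cong (_* vs (Fin.punchIn i j) q) (insertAt-punchIn x i (- e) j)) ⟩
      - e * vs i q + ∑[ j < suc k ] (x j * vs (Fin.punchIn i j) q)
        ≡⟨ solve 3 (λ e v s → (:- e) :* v :+ s := s :+ :- (e :* v)) refl e (vs i q)
             (∑[ j < suc k ] (x j * vs (Fin.punchIn i j) q)) ⟩
      ∑[ j < suc k ] (x j * vs (Fin.punchIn i j) q) - e * vs i q
        ≡⟨ cong (λ s → ∑[ j < suc k ] (x j * vs (Fin.punchIn i j) q) - s)
             (*-distribʳ-sum (vs i q) (λ j → x j * d j)) ⟩
      ∑[ j < suc k ] (x j * vs (Fin.punchIn i j) q) - ∑[ j < suc k ] (x j * d j * vs i q)
        ≡⟨ sum-minus (λ j → x j * vs (Fin.punchIn i j) q) (λ j → x j * d j * vs i q) ⟩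
      ∑[ j < suc k ] (x j * vs (Fin.punchIn i j) q - x j * d j * vs i q)
        ≡⟨ sum-cong-≗ (λ j → solve 4 (λ x a d v → x :* a :+ :- (x :* d :* v) := x :* (a :+ :- (d :* v)))
             refl (x j) (vs (Fin.punchIn i j) q) (d j) (vs i q)) ⟩
      ∑[ j < suc k ] (x j * (vs (Fin.punchIn i j) q - d j * vs i q)) ∎

-- The n + 1 vectors `v ∷ A` in dimension n are dependent. Independence of `A` makes the coefficient
-- of `v` nonzero, so the relation can be solved for `v`.
independent⇒spanning : ∀ {n} {A : Matrix n n} → LinearlyIndependent A → ∀ v → Span A v
independent⇒spanning {n} {A} ind v with dependent n (v ∷ A)
... | x , (i , xᵢ≢0) , eq with x zero ℚ.≟ 0ℚ
...   | yes x₀≡0 = contradiction (x≡0 i) xᵢ≢0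
  where
  x≡0 : ∀ i → x i ≡ 0ℚ
  x≡0 zero    = x₀≡0
  x≡0 (suc i) = ind (tail x) (λ j → trans
    (sym (trans (cong (λ q → q * v j + linearCombination (tail x) A j) x₀≡0)
      (trans (cong (_+ linearCombination (tail x) A j) (ℚ.*-zeroˡ (v j)))
        (ℚ.+-identityˡ (linearCombination (tail x) A j)))))
    (eq j)) i
...   | no x₀≢0 = (λ i → - ℚ.1/ x zero * x (suc i)) , λ j → begin
  v j
    ≡⟨ solve 4 (λ v w a s → v := con 1ℚ :* v) refl (v j) 0ℚ 0ℚ 0ℚ ⟩
  1ℚ * v j
    ≡⟨ cong (_* v j) (ℚ.*-inverseˡ (x zero)) ⟨
  ℚ.1/ x zero * x zero * v j
    ≡⟨ solve 4 (λ w a v s → w :* a :* v := w :* (a :* v :+ s) :+ (:- w) :* s) refl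
         (ℚ.1/ x zero) (x zero) (v j) (linearCombination (tail x) A j) ⟩
  ℚ.1/ x zero * (x zero * v j + linearCombination (tail x) A j)
    + - ℚ.1/ x zero * linearCombination (tail x) A j
    ≡⟨ cong (λ q → ℚ.1/ x zero * q + - ℚ.1/ x zero * linearCombination (tail x) A j) (eq j) ⟩
  ℚ.1/ x zero * 0ℚ + - ℚ.1/ x zero * linearCombination (tail x) A j
    ≡⟨ cong (_+ - ℚ.1/ x zero * linearCombination (tail x) A j) (ℚ.*-zeroʳ (ℚ.1/ x zero)) ⟩
  0ℚ + - ℚ.1/ x zero * linearCombination (tail x) A j
    ≡⟨ ℚ.+-identityˡ _ ⟩
  - ℚ.1/ x zero * linearCombination (tail x) A j
    ≡⟨ *-distribˡ-sum (- ℚ.1/ x zero) (λ i → x (suc i) * A i j) ⟩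
  ∑[ i < n ] (- ℚ.1/ x zero * (x (suc i) * A i j))
    ≡⟨ sum-cong-≗ (λ i → sym (ℚ.*-assoc (- ℚ.1/ x zero) (x (suc i)) (A i j))) ⟩
  linearCombination (λ i → - ℚ.1/ x zero * x (suc i)) A j ∎
  where
  open ≡-Reasoning
  instance _ = ℚ.≢-nonZero x₀≢0

-- The rows of `B` express the unit vectors through the rows of `A`, which gives a left inverse. It
-- is also a right inverse, since `A · B` and `1ᴹ` have the same product with `A` and independence
-- allows `A` to be cancelled.
independent⇒invertible : ∀ {n} {A : Matrix n n} → LinearlyIndependent A → Invertible A
independent⇒invertible {n} {A} ind = B , AB≈1 , BA≈1
  where
  B : Matrix n n
  B i = proj₁ (independent⇒spanning ind (1ᴹ i))
  BA≈1 : B · A ≈ᴹ 1ᴹ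
  BA≈1 i j = sym (proj₂ (independent⇒spanning ind (1ᴹ i)) j)
  AB≈1 : A · B ≈ᴹ 1ᴹ
  AB≈1 i = independent⇒injective ind λ j → trans (linearCombination-assoc (A i) B A j)
    (trans (linearCombination-congʳ (A i) BA≈1 j)
      (trans (linearCombination-1ᴹ (A i) j) (sym (linearCombination-unit i A j))))

-- Bases from an invertible submatrix

-- The factorization A = A[-,ψ] A[φ,ψ]⁻¹ A[φ,-].
module _ {k m n} (A : Matrix m n) (φ : Fin k → Fin m) (ψ : Fin k → Fin n)
         (ind : LinearlyIndependent (λ i j → A (φ i) (ψ j)))
         (rows : ∀ i → Span (A ∘ φ) (A i)) where

  private
    S : Matrix k k
    S i j = A (φ i) (ψ j)
    B = proj₁ (independent⇒invertible ind)
    SB≈1 = proj₁ (proj₂ (independent⇒invertible ind))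
    BS≈1 = proj₂ (proj₂ (independent⇒invertible ind))

  rowBasis : IsBasis (A ∘ φ) (rowSpace A)
  rowBasis = record
    { members     = λ i → member A (φ i)
    ; independent = λ x eq → ind x (eq ∘ ψ)
    ; spanning    = λ _ → span-trans rows
    }

  spanningColumns : ∀ j → Span (transpose (λ i → A i ∘ ψ)) (transpose A j)
  spanningColumns j = (λ q → (B · (A ∘ φ)) q j) , λ i → begin
    A i j
      ≡⟨ proj₂ (rows i) j ⟩
    linearCombination (x i) (A ∘ φ) j
      ≡⟨ linearCombination-congˡ (A ∘ φ) (x≗ i) j ⟩
    linearCombination (linearCombination (A i ∘ ψ) B) (A ∘ φ) j
      ≡⟨ linearCombination-assoc (A i ∘ ψ) B (A ∘ φ) j ⟩
    ∑[ q < k ] (A i (ψ q) * (B · (A ∘ φ)) q j)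
      ≡⟨ sum-cong-≗ (λ q → ℚ.*-comm (A i (ψ q)) ((B · (A ∘ φ)) q j)) ⟩
    ∑[ q < k ] ((B · (A ∘ φ)) q j * A i (ψ q)) ∎
    where
    open ≡-Reasoning
    x : Matrix _ k
    x i = proj₁ (rows i)
    -- Restricting row `i` to the columns `ψ` shows that `x i` times `S` is `A i ∘ ψ`, and `B`
    -- inverts `S`.
    x≗ : ∀ i → x i ≗ linearCombination (A i ∘ ψ) B
    x≗ i l = begin
      x i l                                          ≡⟨ linearCombination-1ᴹ (x i) l ⟨
      linearCombination (x i) 1ᴹ l                   ≡⟨ linearCombination-congʳ (x i) SB≈1 l ⟨
      linearCombination (x i) (S · B) l              ≡⟨ linearCombination-assoc (x i) S B l ⟨
      linearCombination (linearCombination (x i) S) B l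
        ≡⟨ linearCombination-congˡ B (λ q → sym (proj₂ (rows i) (ψ q))) l ⟩
      linearCombination (A i ∘ ψ) B l                ∎

  columnBasis : IsBasis (transpose (λ i → A i ∘ ψ)) (columnSpace A)
  columnBasis = record
    { members     = λ j → member (transpose A) (ψ j)
    -- On the rows `φ` the relation says that `S` times `x` is zero, and multiplying by `B` recovers
    -- `x`. The matrix `λ i _ → x i` has `x` in every column, which lets `linearCombination-assoc`
    -- apply.
    ; independent = λ x eq i → begin
        x i
          ≡⟨ linearCombination-unit i (λ i _ → x i) i ⟨
        linearCombination (1ᴹ i) (λ i _ → x i) i
          ≡⟨ linearCombination-congˡ (λ i _ → x i) (λ q → sym (BS≈1 i q)) i ⟩
        linearCombination (linearCombination (B i) S) (λ i _ → x i) i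
          ≡⟨ linearCombination-assoc (B i) S (λ i _ → x i) i ⟩
        ∑[ l < k ] (B i l * (∑[ q < k ] (S l q * x q)))
          ≡⟨ sum-zero _ (λ l → trans (cong (B i l *_) (trans
               (sum-cong-≗ λ q → ℚ.*-comm (S l q) (x q)) (eq (φ l)))) (ℚ.*-zeroʳ (B i l))) ⟩
        0ℚ ∎
    ; spanning    = λ _ → span-trans spanningColumns
    }
    where open ≡-Reasoning

-- Consequences of a zero block

-- Every step adds at least one; the additive form avoids truncated subtraction.
increasing-growth : ∀ {k} {s : Vector ℕ k} → StrictlyIncreasing s → ∀ i j → i Fin.≤ j →
                    s i ℕ.+ toℕ j ≤ s j ℕ.+ toℕ i
increasing-growth s↑ zero zero _ = ℕ.≤-refl
increasing-growth {suc (suc k)} {s} s↑ zero (suc j) _ = begin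
  s zero ℕ.+ suc (toℕ j)       ≡⟨ ℕ.+-suc (s zero) (toℕ j) ⟩
  suc (s zero) ℕ.+ toℕ j       ≤⟨ ℕ.+-monoˡ-≤ (toℕ j) (s↑ {zero} {suc zero} z<s) ⟩
  s (suc zero) ℕ.+ toℕ j       ≤⟨ increasing-growth (tail-increasing {r = s} s↑) zero j z≤n ⟩
  s (suc j) ℕ.+ 0              ∎
  where open ℕ.≤-Reasoning
increasing-growth {suc k} {s} s↑ (suc i) (suc j) (s≤s i≤j) = begin
  s (suc i) ℕ.+ suc (toℕ j)    ≡⟨ ℕ.+-suc (s (suc i)) (toℕ j) ⟩
  suc (s (suc i) ℕ.+ toℕ j)    ≤⟨ s≤s (increasing-growth (tail-increasing {r = s} s↑) i j i≤j) ⟩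
  suc (s (suc j) ℕ.+ toℕ i)    ≡⟨ ℕ.+-suc (s (suc j)) (toℕ i) ⟨
  s (suc j) ℕ.+ suc (toℕ i)    ∎
  where open ℕ.≤-Reasoning

toℕ≤increasing : ∀ {k} {s : Vector ℕ k} → StrictlyIncreasing s → ∀ i → toℕ i ≤ s i
toℕ≤increasing {suc k} {s} s↑ i = begin
  toℕ i               ≤⟨ ℕ.m≤n+m (toℕ i) (s zero) ⟩
  s zero ℕ.+ toℕ i    ≤⟨ increasing-growth s↑ zero i z≤n ⟩
  s i ℕ.+ 0           ≡⟨ ℕ.+-identityʳ (s i) ⟩
  s i                 ∎
  where open ℕ.≤-Reasoning

-- Rows from a on vanish on the columns before d; ψ enumerates all columns from d on.
record Block {k m n} (r : Vector ℕ m) (c : Vector ℕ n) (ψ : Fin k → Fin n) : Set where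
  field
    a d   : ℕ
    a≤k   : a ≤ k
    size  : d ℕ.+ k ≡ a ℕ.+ n
    below : ∀ i j → a ≤ toℕ i → toℕ j < d → c j < r i
    left  : ∀ l → toℕ l < a → toℕ (ψ l) < d
    right : ∀ l → a ≤ toℕ l → toℕ (ψ l) ℕ.+ a ≡ d ℕ.+ toℕ l

module _ {k m n} {r : Vector ℕ m} {c : Vector ℕ n} (r↑ : StrictlyIncreasing r) (c↑ : StrictlyIncreasing c)
         {α : Fin k → Fin m} {ψ : Fin k → Fin n} (toℕ-α : ∀ i → toℕ (α i) ≡ toℕ i)
         (ψ-increasing : StrictlyIncreasing (toℕ ∘ ψ)) (ordered : ∀ i → r (α i) ≤ c (ψ i))
         (block : Block r c ψ) where

  private
    r̂ ĉ : Vector ℕ k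
    r̂ = r ∘ α
    ĉ = c ∘ ψ

  α-increasing : StrictlyIncreasing (toℕ ∘ α)
  α-increasing {i} {j} i<j = subst₂ _<_ (sym (toℕ-α i)) (sym (toℕ-α j)) i<j

  r̂↑ : StrictlyIncreasing r̂
  r̂↑ {i} {j} i<j = r↑ (α-increasing {i} {j} i<j)

  ĉ↑ : StrictlyIncreasing ĉ
  ĉ↑ {i} {j} i<j = c↑ (ψ-increasing {i} {j} i<j)

  open Block block

  maximalOrderedSubPair : IsMaximalOrderedSubPair r̂ ĉ r c
  maximalOrderedSubPair = record
    { isOrderedSubPair = record
      { rows    = α , (λ {i} {j} → α-increasing {i} {j}) , λ _ → refl
      ; columns = ψ , (λ {i} {j} → ψ-increasing {i} {j}) , λ _ → refl
      ; ordered = ordered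
      }
    ; maximal = λ s t pair → bound s t pair
    }
    where
    -- The row at position `a` of the pair has index at least `a`, so the zero block forces its
    -- column to have index at least `d`. At most `n - d` columns remain from there on, hence the
    -- length is at most `a + n - d = k`.
    bound : ∀ {l} (s t : Vector ℕ l) → IsOrderedSubPair s t r c → l ≤ k
    bound {zero} s t pair = z≤n
    bound {suc l} s t pair with a ℕ.≤? l
    ... | no a≰l = ℕ.≤-trans (ℕ.≰⇒> a≰l) a≤k
    ... | yes a≤l = ℕ.+-cancelˡ-≤ d (suc l) k (begin
      d ℕ.+ suc l                     ≡⟨ ℕ.+-suc d l ⟩
      suc (d ℕ.+ l)                   ≤⟨ s≤s (ℕ.+-mono-≤ d≤χ (ℕ.≤-reflexive (sym (Fin.toℕ-fromℕ l)))) ⟩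
      suc (toℕ (χ x) ℕ.+ toℕ (Fin.fromℕ l))
        ≤⟨ s≤s (increasing-growth {s = toℕ ∘ χ} χ↑ x (Fin.fromℕ l) (Fin.≤fromℕ x)) ⟩
      suc (toℕ (χ (Fin.fromℕ l)) ℕ.+ toℕ x)
        ≤⟨ ℕ.+-mono-≤ (Fin.toℕ<n (χ (Fin.fromℕ l))) (ℕ.≤-reflexive toℕ-x) ⟩
      n ℕ.+ a                     ≡⟨ ℕ.+-comm (n) a ⟩
      a ℕ.+ n                     ≡⟨ size ⟨
      d ℕ.+ k                         ∎)
      where
      open ℕ.≤-Reasoning
      open IsOrderedSubPair pair using (rows; columns)
      φ = proj₁ rows
      χ = proj₁ columns
      χ↑ : StrictlyIncreasing (toℕ ∘ χ)
      χ↑ = proj₁ (proj₂ columns)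
      x : Fin (suc l)
      x = fromℕ< (s≤s a≤l)
      toℕ-x : toℕ x ≡ a
      toℕ-x = Fin.toℕ-fromℕ< (s≤s a≤l)
      a≤φ : a ≤ toℕ (φ x)
      a≤φ = subst (_≤ toℕ (φ x)) toℕ-x (toℕ≤increasing {s = toℕ ∘ φ} (proj₁ (proj₂ rows)) x)
      d≤χ : d ≤ toℕ (χ x)
      d≤χ = ℕ.≮⇒≥ λ χ<d → ℕ.<⇒≱ (below (φ x) (χ x) a≤φ χ<d)
        (subst₂ _≤_ (proj₂ (proj₂ rows) x) (proj₂ (proj₂ columns) x) (IsOrderedSubPair.ordered pair x))

  independentRows : LinearlyIndependent T[ r̂ , ĉ ]
  independentRows x eq l = prefix≡0 k x r̂ ĉ
    (λ {i} {j} → r̂↑ {i} {j}) (λ {i} {j} → ĉ↑ {i} {j}) ordered ℕ.≤-refl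
    (λ i _ _ k≤i → contradiction (Fin.toℕ<n i) (ℕ.≤⇒≯ k≤i))
    (λ j _ → trans (newton≡sum x r̂ (ĉ j)) (eq j)) l (Fin.toℕ<n l)

  ĉ<r : ∀ i l → toℕ l < a → a ≤ toℕ i → ĉ l < r i
  ĉ<r i l l<a a≤i = below i (ψ l) a≤i (left l l<a)

  a≤α : ∀ {i} → a ≤ toℕ i → a ≤ toℕ (α i)
  a≤α {i} a≤i = subst (a ≤_) (sym (toℕ-α i)) a≤i

  -- Solving `right` for the position gives `a + (toℕ j ∸ d)`, and `size` puts it below `k`.
  ψ-surjective : ∀ j → d ≤ toℕ j → ∃[ l ] ψ l ≡ j
  ψ-surjective j d≤j = l , Fin.toℕ-injective (ℕ.+-cancelʳ-≡ a _ _ (begin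
    toℕ (ψ l) ℕ.+ a      ≡⟨ right l (subst (a ≤_) (sym toℕ-l) (ℕ.m≤m+n a (toℕ j ∸ d))) ⟩
    d ℕ.+ toℕ l                    ≡⟨ d+l≡a+j ⟩
    a ℕ.+ toℕ j                    ≡⟨ ℕ.+-comm a (toℕ j) ⟩
    toℕ j ℕ.+ a                    ∎))
    where
    open ≡-Reasoning
    d+ : d ℕ.+ (a ℕ.+ (toℕ j ∸ d)) ≡ a ℕ.+ toℕ j
    d+ = begin
      d ℕ.+ (a ℕ.+ (toℕ j ∸ d))    ≡⟨ ℕ.+-assoc d a (toℕ j ∸ d) ⟨
      d ℕ.+ a ℕ.+ (toℕ j ∸ d)      ≡⟨ cong (ℕ._+ (toℕ j ∸ d)) (ℕ.+-comm d a) ⟩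
      a ℕ.+ d ℕ.+ (toℕ j ∸ d)      ≡⟨ ℕ.+-assoc a d (toℕ j ∸ d) ⟩
      a ℕ.+ (d ℕ.+ (toℕ j ∸ d))    ≡⟨ cong (a ℕ.+_) (ℕ.m+[n∸m]≡n d≤j) ⟩
      a ℕ.+ toℕ j                  ∎
    l<k : a ℕ.+ (toℕ j ∸ d) < k
    l<k = ℕ.+-cancelˡ-< d _ _ (subst₂ _<_ (sym d+) (sym size) (ℕ.+-monoʳ-< a (Fin.toℕ<n j)))
    l : Fin k
    l = fromℕ< l<k
    toℕ-l : toℕ l ≡ a ℕ.+ (toℕ j ∸ d)
    toℕ-l = Fin.toℕ-fromℕ< l<k
    d+l≡a+j : d ℕ.+ toℕ l ≡ a ℕ.+ toℕ j
    d+l≡a+j = trans (cong (d ℕ.+_) toℕ-l) d+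

  -- Some `y` matches row `i` on the columns `ĉ`. The row vanishes on the first `a` of them, so
  -- `prefix≡0` clears the first `a` coefficients, and both sides vanish on all columns before `d`.
  -- The columns from `d` on all belong to `ĉ`.
  newRow-spanned : ∀ i → k ≤ toℕ i → Span T[ r̂ , c ] (T[ r , c ] i)
  newRow-spanned i k≤i = y , λ j → trans (agrees j) (newton≡sum y r̂ (c j))
    where
    a≤i : a ≤ toℕ i
    a≤i = ℕ.≤-trans a≤k k≤i
    solution : Span T[ r̂ , ĉ ] (T[ r , ĉ ] i)
    solution = independent⇒spanning independentRows (T[ r , ĉ ] i)
    y : Vector ℚ k
    y = proj₁ solution
    agrees-ĉ : ∀ l → T (r i) (ĉ l) ≡ newton y r̂ (ĉ l)
    agrees-ĉ l = trans (proj₂ solution l) (sym (newton≡sum y r̂ (ĉ l)))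
    y≡0 : ∀ l → toℕ l < a → y l ≡ 0ℚ
    y≡0 = prefix≡0 a y r̂ ĉ
      (λ {i} {j} → r̂↑ {i} {j}) (λ {i} {j} → ĉ↑ {i} {j}) ordered a≤k
      (λ i l l<a a≤i → ĉ<r (α i) l l<a (a≤α {i} a≤i))
      (λ l l<a → trans (sym (agrees-ĉ l)) (j<i⇒Tij≡0 (ĉ<r i l l<a a≤i)))
    absent : ∀ j → toℕ j < d → ∀ l → c j < r̂ l ⊎ y l ≡ 0ℚ
    absent j j<d l = Sum.[ inj₂ ∘ y≡0 l , (λ a≤l → inj₁ (below (α l) j (a≤α {l} a≤l) j<d)) ]′
      (ℕ.<-≤-connex (toℕ l) a)
    agrees : ∀ j → T (r i) (c j) ≡ newton y r̂ (c j)
    agrees j = Sum.[ agrees-left , agrees-right ]′ (ℕ.<-≤-connex (toℕ j) d)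
      where
      agrees-left : toℕ j < d → T (r i) (c j) ≡ newton y r̂ (c j)
      agrees-left j<d = trans (j<i⇒Tij≡0 (below i j a≤i j<d))
        (sym (newton-zero y r̂ (c j) (absent j j<d)))
      agrees-right : d ≤ toℕ j → T (r i) (c j) ≡ newton y r̂ (c j)
      agrees-right d≤j = subst (λ j → T (r i) (c j) ≡ newton y r̂ (c j))
        (proj₂ (ψ-surjective j d≤j)) (agrees-ĉ (proj₁ (ψ-surjective j d≤j)))

  oldRow-spanned : ∀ i → toℕ i < k → Span T[ r̂ , c ] (T[ r , c ] i)
  oldRow-spanned i i<k = subst (λ i → Span T[ r̂ , c ] (T[ r , c ] i)) α-l≡i (member T[ r̂ , c ] l)
    where
    l : Fin k
    l = fromℕ< i<k
    α-l≡i : α l ≡ i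
    α-l≡i = Fin.toℕ-injective (trans (toℕ-α l) (Fin.toℕ-fromℕ< i<k))

  spanningRows : ∀ i → Span T[ r̂ , c ] (T[ r , c ] i)
  spanningRows i = Sum.[ oldRow-spanned i , newRow-spanned i ]′ (ℕ.<-≤-connex (toℕ i) k)

  orderedSubPair-rank : IsMaximalOrderedSubPair r̂ ĉ r c
           × HasRank T[ r , c ] k
           × Invertible T[ r̂ , ĉ ]
           × IsBasis T[ r̂ , c ] (rowSpace T[ r , c ])
           × IsBasis (transpose T[ r , ĉ ]) (columnSpace T[ r , c ])
  orderedSubPair-rank =
      maximalOrderedSubPair
    , (transpose T[ r , ĉ ] , columnBasis T[ r , c ] α ψ independentRows spanningRows)
    , independent⇒invertible {A = T[ r̂ , ĉ ]} independentRows
    , rowBasis T[ r , c ] α ψ independentRows spanningRows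
    , columnBasis T[ r , c ] α ψ independentRows spanningRows

-- The zero block of the greedy choice

module _ {m n} (r : Vector ℕ (suc m)) (c : Vector ℕ (suc n))
         (r↑ : StrictlyIncreasing r) (c↑ : StrictlyIncreasing c) (r₀≤cₙ : head r ≤ last c) where

  open Greedy r c r↑ r₀≤cₙ

  private
    k : ℕ
    k = suc (toℕ p)

  βℕ-cong : ∀ {i j} .(i≤M : i ≤ toℕ M) .(j≤M : j ≤ toℕ M) → i ≡ j → βℕ i i≤M ≡ βℕ j j≤M
  βℕ-cong _ _ refl = refl

  βℕ-mono-< : ∀ i {j} .(i≤M : i ≤ toℕ M) .(j≤M : j ≤ toℕ M) → i < j → βℕ i i≤M < βℕ j j≤M
  βℕ-mono-< i {j} i≤M j≤M i<j = ℕ.≤-trans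
    (ℕ.m≤n⊔m (toℕ (first (fromℕ< (s≤s (ℕ.≤-trans i<j j≤M))))) (suc (βℕ i i≤M)))
    (βℕ-mono-≤ {suc i} j (ℕ.≤-trans i<j j≤M) j≤M i<j)

  first≤βℕ : ∀ i .(i≤M : i ≤ toℕ M) → toℕ (first (fromℕ< (s≤s i≤M))) ≤ βℕ i i≤M
  first≤βℕ zero    i≤M = ℕ.≤-refl
  first≤βℕ (suc i) i<M = ℕ.m≤m⊔n _ _

  first≤β : ∀ i → toℕ (first i) ≤ β i
  first≤β i = subst (λ j → toℕ (first j) ≤ β i) (Fin.fromℕ<-toℕ i (Fin.toℕ<n i))
    (first≤βℕ (toℕ i) (ℕ.≤-pred (Fin.toℕ<n i)))

  toℕ-row : ∀ i → toℕ (row i) ≡ toℕ i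
  toℕ-row i = Fin.toℕ-inject≤ i (Fin.toℕ<n M)

  toℕ-α : ∀ i → toℕ (α i) ≡ toℕ i
  toℕ-α i = trans (toℕ-row (upTo-p i)) (Fin.toℕ-inject≤ i (Fin.toℕ<n p))

  p≤M : toℕ p ≤ toℕ M
  p≤M = ℕ.≤-pred (Fin.toℕ<n p)

  toℕ≤M : ∀ (i : Fin k) → toℕ i ≤ toℕ M
  toℕ≤M i = ℕ.≤-trans (ℕ.≤-pred (Fin.toℕ<n i)) p≤M

  toℕ-columnIndex : ∀ i → toℕ (columnIndex i) ≡ βℕ (toℕ i) (toℕ≤M i)
  toℕ-columnIndex i = trans (Fin.toℕ-fromℕ< (s≤s (β≤n i)))
    (βℕ-cong (ℕ.≤-pred (Fin.toℕ<n (upTo-p i))) (toℕ≤M i) (Fin.toℕ-inject≤ i (Fin.toℕ<n p)))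

  columnIndex-increasing : StrictlyIncreasing (toℕ ∘ columnIndex)
  columnIndex-increasing {i} {j} i<j = subst₂ _<_ (sym (toℕ-columnIndex i)) (sym (toℕ-columnIndex j))
    (βℕ-mono-< (toℕ i) (toℕ≤M i) (toℕ≤M j) i<j)

  r̂≤ĉ : ∀ i → r̂ i ≤ ĉ i
  r̂≤ĉ i = ℕ.≤-trans (proj₁ (proj₂ (first-min (upTo-p i))))
    (strictlyIncreasing⇒monotone c↑ {first (upTo-p i)} {columnIndex i}
      (ℕ.≤-trans (first≤β (upTo-p i)) (ℕ.≤-reflexive (sym (Fin.toℕ-fromℕ< (s≤s (β≤n i)))))))

  -- From row a to row i the greedy choice takes consecutive columns, starting with
  -- the first column not below row a.
  record Run (i : ℕ) (i≤M : i ≤ toℕ M) : Set where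
    field
      start       : ℕ
      start≤i     : start ≤ i
    start≤M : start ≤ toℕ M
    start≤M = ℕ.≤-trans start≤i i≤M
    field
      β-start     : βℕ start start≤M ≡ toℕ (first (fromℕ< (s≤s start≤M)))
      consecutive : ∀ l (l≤i : l ≤ i) → start ≤ l →
                    βℕ l (ℕ.≤-trans l≤i i≤M) ℕ.+ start ≡ βℕ start start≤M ℕ.+ l

  run : ∀ i (i≤M : i ≤ toℕ M) → Run i i≤M
  run zero i≤M = record
    { start       = 0
    ; start≤i     = z≤n
    ; β-start     = refl
    ; consecutive = λ { zero _ _ → refl }
    }
  -- The maximum defining the next column is attained either by `first`, which starts a new run, or
  -- by the successor of the previous column, which extends the current one.
  run (suc i) i<M with ℕ.≤-total (suc (βℕ i (ℕ.<⇒≤ i<M))) (toℕ (first (fromℕ< (s≤s i<M))))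
  ... | inj₁ β<first = record
    { start       = suc i
    ; start≤i     = ℕ.≤-refl
    ; β-start     = ℕ.m≥n⇒m⊔n≡m β<first
    ; consecutive = λ l l≤i i≤l → cong₂ ℕ._+_ (βℕ-cong (ℕ.≤-trans l≤i i<M) i<M (ℕ.≤-antisym l≤i i≤l))
                                   (ℕ.≤-antisym i≤l l≤i)
    }
  ... | inj₂ first≤β+1 = record
    { start       = start
    ; start≤i     = ℕ.m≤n⇒m≤1+n start≤i
    ; β-start     = β-start
    ; consecutive = λ l l≤1+i start≤l → case l l≤1+i start≤l (ℕ.m≤n⇒m<n∨m≡n l≤1+i)
    }
    where
    open Run (run i (ℕ.<⇒≤ i<M))
    case : ∀ l (l≤1+i : l ≤ suc i) → start ≤ l → l < suc i ⊎ l ≡ suc i →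
           βℕ l (ℕ.≤-trans l≤1+i i<M) ℕ.+ start ≡ βℕ start start≤M ℕ.+ l
    case l _ start≤l (inj₁ (s≤s l≤i)) = consecutive l l≤i start≤l
    case l _ start≤l (inj₂ refl) = trans (cong (ℕ._+ start) (ℕ.m≤n⇒m⊔n≡n first≤β+1))
      (trans (cong suc (consecutive i ℕ.≤-refl start≤i)) (sym (ℕ.+-suc (βℕ start start≤M) i)))

  -- Row `p + 1` still has its `first` column within `n`, so only the successor of the previous
  -- column can push its choice beyond `n`.
  βp≡n : toℕ p < toℕ M → βℕ (toℕ p) p≤M ≡ n
  βp≡n p<M = ℕ.≤-antisym (proj₁ (proj₂ p-max)) (ℕ.≮⇒≥ λ βp<n → n<β-next
      (ℕ.⊔-lub (ℕ.≤-pred (Fin.toℕ<n (first next))) βp<n))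
    where
    next : Fin (suc (toℕ M))
    next = fromℕ< (s≤s p<M)
    β-next : β next ≡ βℕ (suc (toℕ p)) p<M
    β-next = βℕ-cong (ℕ.≤-pred (Fin.toℕ<n next)) p<M (Fin.toℕ-fromℕ< (s≤s p<M))
    n<β-next : ¬ βℕ (suc (toℕ p)) p<M ≤ n
    n<β-next β≤n = ℕ.1+n≰n (subst (_≤ toℕ p) (Fin.toℕ-fromℕ< (s≤s p<M))
      (proj₂ (proj₂ p-max) next (subst (_≤ n) (sym β-next) β≤n)))

  -- If `p` is `M`, all rows after `p` exceed the last column and the block takes in every column.
  -- Otherwise the columns are used up, and the last run supplies the block: `a` is its first row
  -- and `d` its first column.
  block : Block r c columnIndex
  block = Sum.[ incomplete , complete ]′ (ℕ.m≤n⇒m<n∨m≡n p≤M)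
   where
   complete : toℕ p ≡ toℕ M → Block r c columnIndex
   complete p≡M = record
     { a     = k
     ; d     = suc n
     ; a≤k   = ℕ.≤-refl
     ; size  = ℕ.+-comm (suc n) k
     ; below = λ i j p<i _ → ℕ.≤-<-trans
         (strictlyIncreasing⇒monotone c↑ {j} {Fin.fromℕ n} (Fin.≤fromℕ j))
         (ℕ.≰⇒> λ rᵢ≤cₙ → ℕ.<⇒≱ (subst (_< toℕ i) p≡M p<i) (proj₂ (proj₂ M-max) i rᵢ≤cₙ))
     ; left  = λ l _ → Fin.toℕ<n (columnIndex l)
     ; right = λ l k≤l → contradiction (Fin.toℕ<n l) (ℕ.≤⇒≯ k≤l)
     }
   incomplete : toℕ p < toℕ M → Block r c columnIndex
   incomplete p<M = record
     { a     = start
     ; d     = βℕ start start≤M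
     ; a≤k   = ℕ.m≤n⇒m≤1+n start≤i
     ; size  = begin
         βℕ start start≤M ℕ.+ k              ≡⟨ ℕ.+-suc _ (toℕ p) ⟩
         suc (βℕ start start≤M ℕ.+ toℕ p)    ≡⟨ cong suc (consecutive (toℕ p) ℕ.≤-refl start≤i) ⟨
         suc (βℕ (toℕ p) p≤M ℕ.+ start)      ≡⟨ cong (λ b → suc (b ℕ.+ start)) (βp≡n p<M) ⟩
         suc n ℕ.+ start                     ≡⟨ ℕ.+-comm (suc n) start ⟩
         start ℕ.+ suc n                     ∎
     -- Minimality of `first` puts the columns before `d` below the row `start`, hence below all
     -- later rows.
     ; below = λ i j start≤i j<d → ℕ.<-≤-trans
         (ℕ.≰⇒> λ r≤cⱼ → ℕ.<⇒≱ (subst (toℕ j <_) β-start j<d) (proj₂ (proj₂ (first-min startRow)) j r≤cⱼ))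
         (strictlyIncreasing⇒monotone r↑ {row startRow} {i}
           (subst (_≤ toℕ i) (sym (trans (toℕ-row startRow) (Fin.toℕ-fromℕ< (s≤s start≤M)))) start≤i))
     ; left  = λ l l<start → subst (_< βℕ start start≤M) (sym (toℕ-columnIndex l))
         (βℕ-mono-< (toℕ l) (toℕ≤M l) start≤M l<start)
     ; right = λ l start≤l → trans (cong (ℕ._+ start) (toℕ-columnIndex l))
         (consecutive (toℕ l) (ℕ.≤-pred (Fin.toℕ<n l)) start≤l)
     }
     where
     open ≡-Reasoning
     open Run (run (toℕ p) p≤M)
     startRow : Fin (suc (toℕ M))
     startRow = fromℕ< (s≤s start≤M)

-- The zero matrix and the conclusion

zero⇒rank-0 : ∀ {m n} {A : Matrix m n} → A ≈ᴹ 0ᴹ → HasRank A 0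
zero⇒rank-0 A≈0 = (λ ()) , record
  { members     = λ ()
  ; independent = λ x _ ()
  ; spanning    = λ v (x , v≗) → (λ ()) , λ i → trans (v≗ i)
      (sum-zero _ λ j → trans (cong (x j *_) (A≈0 i j)) (ℚ.*-zeroʳ (x j)))
  }

head>last⇒T≈0 : ∀ {m n} {r : Vector ℕ (suc m)} {c : Vector ℕ (suc n)} →
      StrictlyIncreasing r → StrictlyIncreasing c → head r > last c → T[ r , c ] ≈ᴹ 0ᴹ
head>last⇒T≈0 {n = n} r↑ c↑ r₀>cₙ i j = j<i⇒Tij≡0 (ℕ.≤-<-trans
  (strictlyIncreasing⇒monotone c↑ {j} {Fin.fromℕ n} (Fin.≤fromℕ j))
  (ℕ.<-≤-trans r₀>cₙ (strictlyIncreasing⇒monotone r↑ {zero} {i} z≤n)))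

theorem3 :
    ∀ (m n : ℕ) (r : Vector ℕ (suc m)) (c : Vector ℕ (suc n)) →
    (r↑ : StrictlyIncreasing r) → StrictlyIncreasing c →
    (head r > last c → T[ r , c ] ≈ᴹ 0ᴹ × HasRank T[ r , c ] 0)
    ×
    ((r₀≤cₙ : head r ≤ last c) →
      let open Greedy r c r↑ r₀≤cₙ in
      IsMaximalOrderedSubPair r̂ ĉ r c
      × HasRank T[ r , c ] (suc (toℕ p))
      × Invertible T[ r̂ , ĉ ]
      × IsBasis T[ r̂ , c ] (rowSpace T[ r , c ])
      × IsBasis (transpose T[ r , ĉ ]) (columnSpace T[ r , c ]))
proj₁ (theorem3 m n r c r↑ c↑) r₀>cₙ = head>last⇒T≈0 {r = r} {c} r↑ c↑ r₀>cₙ ,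
  zero⇒rank-0 {A = T[ r , c ]} (head>last⇒T≈0 {r = r} {c} r↑ c↑ r₀>cₙ)
proj₂ (theorem3 m n r c r↑ c↑) r₀≤cₙ = orderedSubPair-rank r↑ c↑ {α = α} {ψ = columnIndex} α≡ ψ↑ ordered blocks
  where
  open Greedy r c r↑ r₀≤cₙ
  α≡ : ∀ i → toℕ (α i) ≡ toℕ i
  α≡ = toℕ-α r c r↑ c↑ r₀≤cₙ
  ψ↑ : StrictlyIncreasing (toℕ ∘ columnIndex)
  ψ↑ {i} {j} = columnIndex-increasing r c r↑ c↑ r₀≤cₙ {i} {j}
  ordered : ∀ i → r (α i) ≤ c (columnIndex i)
  ordered = r̂≤ĉ r c r↑ c↑ r₀≤cₙ
  blocks : Block r c columnIndex
  blocks = block r c r↑ c↑ r₀≤cₙ
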